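{- Let $\Sigma$ be a finite alphabet, and let $\ell$ be the language semantics of the syntactic automaton $(\mathcal{T}_{\mathsf{SF}_1},o,\delta)$ of $\mathsf{SF}_1$-expressions. For all $e\in\mathcal{T}_{\mathsf{SF}_1}$ we have $\ell(e)=[\![e]\!]_{\mathsf{SF}_1}$.
   Context: Let $\Sigma$ be a finite alphabet and let $\mathcal{P}_n(\Sigma)$ be the set of non-empty subsets of $\Sigma$. Terms. The semilattice terms $\mathcal{T}_{\mathsf{SL}}$ are given by $e,f ::= a\in\Sigma \mid e\times f$. The $\mathsf{SF}_1$-expressions $\mathcal{T}_{\mathsf{SF}_1}$ are given by $e,f ::= 0\mid 1\mid a\in\mathcal{T}_{\mathsf{SL}}\mid e+f\mid e\cdot f\mid e\times f\mid e^*\mid H(e)$ (the $\times$ of two semilattice terms is the same term whether formed in $\mathcal{T}_{\mathsf{SL}}$ or in $\mathcal{T}_{\mathsf{SF}_1}$). Semantics. Synchronous strings are words over the alphabet $\mathcal{P}_n(\Sigma)$; synchronous languages are sets of synchronous strings, with the usual union, concatenation and Kleene star. The synchronous product of strings is defined by $u\times\varepsilon=u=\varepsilon\times u$ and $(x u)\times(y v)=(x\cup y)(u\times v)$ for $x,y\in\mathcal{P}_n(\Sigma)$, and of languages by $K\times L=\{u\times v: u\in K,v\in L\}$. Define $[\![-]\!]_{\mathsf{SL}}:\mathcal{T}_{\mathsf{SL}}\to\mathcal{P}_n(\Sigma)$ by $[\![a]\!]_{\mathsf{SL}}=\{a\}$ for $a\in\Sigma$ and $[\![e\times f]\!]_{\mathsf{SL}}=[\![e]\!]_{\mathsf{SL}}\cup[\![f]\!]_{\mathsf{SL}}$.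 The map $[\![-]\!]_{\mathsf{SF}_1}$ from $\mathcal{T}_{\mathsf{SF}_1}$ to synchronous languages is given by $[\![0]\!]=\emptyset$, $[\![1]\!]=\{\varepsilon\}$, $[\![a]\!]=\{[\![a]\!]_{\mathsf{SL}}\}$ (a single one-letter word) for $a\in\mathcal{T}_{\mathsf{SL}}$, $[\![e+f]\!]=[\![e]\!]\cup[\![f]\!]$, $[\![e\cdot f]\!]=[\![e]\!]\cdot[\![f]\!]$, $[\![e\times f]\!]=[\![e]\!]\times[\![f]\!]$, $[\![e^*]\!]=[\![e]\!]^*$, $[\![H(e)]\!]=[\![e]\!]\cap\{\varepsilon\}$. Partial derivatives. The termination map $o:\mathcal{T}_{\mathsf{SF}_1}\to\{0,1\}$ is defined by $o(0)=0$, $o(1)=1$, $o(a)=0$ for $a\in\Sigma$, $o(e^*)=1$, $o(e+f)=\max(o(e),o(f))$, $o(e\cdot f)=o(e\times f)=\min(o(e),o(f))$, $o(H(e))=o(e)$. The continuation map $\delta:\mathcal{T}_{\mathsf{SF}_1}\times\mathcal{P}_n(\Sigma)\to\mathcal{P}(\mathcal{T}_{\mathsf{SF}_1})$ is defined by $\delta(0,A)=\delta(1,A)=\delta(H(e),A)=\emptyset$; for $a\in\Sigma$, $\delta(a,A)=\{1\}$ if $A=\{a\}$ and $\emptyset$ otherwise; $\delta(e+f,A)=\delta(e,A)\cup\delta(f,A)$; $\delta(e\cdot f,A)=\{e'\cdot f: e'\in\delta(e,A)\}\cup\Delta(f,e,A)$; $\delta(e^*,A)=\{e'\cdot e^*: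 e'\in\delta(e,A)\}$; $\delta(e\times f,A)=\Delta(e,f,A)\cup\Delta(f,e,A)\cup\{e'\times f': e'\in\delta(e,B_1), f'\in\delta(f,B_2), B_1,B_2\in\mathcal{P}_n(\Sigma), B_1\cup B_2=A\}$; where $\Delta(e,f,A)=\delta(e,A)$ if $o(f)=1$ and $\emptyset$ otherwise. The syntactic automaton is the non-deterministic automaton over the alphabet $\mathcal{P}_n(\Sigma)$ with state set $\mathcal{T}_{\mathsf{SF}_1}$, termination function $o$ and transition function $\delta$. Its semantics $\ell$ is the unique map from $\mathcal{T}_{\mathsf{SF}_1}$ to synchronous languages satisfying, for all $e$, $\ell(e)=\{\varepsilon : o(e)=1\}\cup\bigcup_{A\in\mathcal{P}_n(\Sigma)}\bigcup_{e'\in\delta(e,A)}\{A\}\cdot\ell(e')$; equivalently, $\ell(e)$ is the language accepted from state $e$. -}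

module Defs where

open import Data.Bool.Base using (Bool; true; false; _∨_; _∧_; if_then_else_)
open import Data.Fin.Base using (Fin)
import Data.Fin.Subset as Sub
open import Data.Fin.Subset.Properties using (x∈⁅x⁆; p⊆p∪q)
open import Data.List.Base using (List; []; _∷_; [_]; _++_)
open import Data.Nat.Base using (ℕ; zero; suc)
open import Data.Product.Base using (∃; ∃₂; _×_; _,_; proj₁; proj₂)
open import Data.Sum.Base using (inj₁; inj₂)
open import Level using (0ℓ)
open import Relation.Binary.PropositionalEquality using (_≡_; refl)
open import Relation.Unary
  using (Pred; _∈_; _≐_; _∪_; _∩_; ∅; ｛_｝; ⋃)

private
  variable
    n : ℕ
    X : Set

Language : Set → Set₁
Language X = Pred (List X) 0ℓ

infixr 7 _·ᴸ_

_·ᴸ_ : Language X → Language X → Language X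
(K ·ᴸ L) w = ∃₂ λ u v → u ∈ K × v ∈ L × w ≡ u ++ v

_^ᴸ_ : Language X → ℕ → Language X
L ^ᴸ zero  = ｛ [] ｝
L ^ᴸ suc k = L ·ᴸ (L ^ᴸ k)

_⋆ᴸ : Language X → Language X
L ⋆ᴸ = ⋃ ℕ (L ^ᴸ_)

record Automaton (X : Set) : Set₁ where
  field
    State       : Set
    termination : State → Bool
    transition  : State → X → Pred State 0ℓ

  semantics : State → Language X
  semantics s []      = termination s ≡ true
  semantics s (x ∷ w) = ∃ λ s′ → s′ ∈ transition s x × semantics s′ w

  unfold : (State → Language X) → State → Language X
  unfold m s =
    (λ w → termination s ≡ true × w ∈ ｛ [] ｝) ∪
    (⋃[ x ∶ X ] ⋃[ s′ ∶ ∃ (transition s x) ] (｛ [ x ] ｝ ·ᴸ m (proj₁ s′)))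

  -- semantics is, up to extensional equality of languages, the unique
  -- map m with m s = unfold m s for all s.
  semantics-unfold : ∀ s → semantics s ≐ unfold semantics s
  semantics-unfold s = to , from
    where
    to : ∀ {w} → w ∈ semantics s → w ∈ unfold semantics s
    to {[]}    p             = inj₁ (p , refl)
    to {x ∷ w} (s′ , δ , p)  = inj₂ (x , (s′ , δ) , [ x ] , w , refl , p , refl)

    from : ∀ {w} → w ∈ unfold semantics s → w ∈ semantics s
    from (inj₁ (p , refl)) = p
    from (inj₂ (x , (s′ , δ) , _ , w , refl , p , refl)) = s′ , δ , p

  semantics-unique : (m : State → Language X) → (∀ s → m s ≐ unfold m s) →
                     ∀ s → m s ≐ semantics s
  semantics-unique m eq s = to s _ , from s _
    where
    to : ∀ s w → w ∈ m s → w ∈ semantics s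
    to s w p with proj₁ (eq s) p
    ... | inj₁ (q , refl) = q
    ... | inj₂ (x , (s′ , δ) , _ , v , refl , q , refl) = s′ , δ , to s′ v q

    from : ∀ s w → w ∈ semantics s → w ∈ m s
    from s []      p            = proj₂ (eq s) (inj₁ (p , refl))
    from s (x ∷ w) (s′ , δ , p) =
      proj₂ (eq s) (inj₂ (x , (s′ , δ) , [ x ] , w , refl , from s′ w p , refl))

-- The alphabet Σ is Fin n.  Non-emptiness is an irrelevant field, so that two elements of 𝒫ₙ n are
-- propositionally equal as soon as their underlying subsets are.
record 𝒫ₙ (n : ℕ) : Set where
  constructor ⟨_,_⟩
  field
    subset    : Sub.Subset n
    .nonempty : Sub.Nonempty subset

⁅_⁆ : Fin n → 𝒫ₙ n
⁅ a ⁆ = ⟨ Sub.⁅ a ⁆ , (a , x∈⁅x⁆ a) ⟩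

infixr 6 _⊔_

_⊔_ : 𝒫ₙ n → 𝒫ₙ n → 𝒫ₙ n
⟨ A , p ⟩ ⊔ ⟨ B , q ⟩ = ⟨ A Sub.∪ B , (proj₁ p , p⊆p∪q B (proj₂ p)) ⟩

SyncString : ℕ → Set
SyncString n = List (𝒫ₙ n)

SyncLanguage : ℕ → Set₁
SyncLanguage n = Language (𝒫ₙ n)

infixr 7 _⊗ˢ_ _⊗ᴸ_

_⊗ˢ_ : SyncString n → SyncString n → SyncString n
[]      ⊗ˢ v       = v
(x ∷ u) ⊗ˢ []      = x ∷ u
(x ∷ u) ⊗ˢ (y ∷ v) = (x ⊔ y) ∷ (u ⊗ˢ v)

_⊗ᴸ_ : SyncLanguage n → SyncLanguage n → SyncLanguage n
(K ⊗ᴸ L) w = ∃₂ λ u v → u ∈ K × v ∈ L × w ≡ u ⊗ˢ v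

-- The synchronous product × is written ⊗.
infixl 8 _⋆
infixr 7 _⊗_ _⊗ₛₗ_
infixr 6 _·_
infixr 5 _+_

data 𝒯SL (n : ℕ) : Set where
  letter : Fin n → 𝒯SL n
  _⊗ₛₗ_  : 𝒯SL n → 𝒯SL n → 𝒯SL n

-- A product of semilattice terms is the same SF₁-expression whether the
-- product is formed in 𝒯SL or in 𝒯SF₁.  Hence only letters occur as
-- generators here, and 𝒯SL is included in 𝒯SF₁ via ι below.
data 𝒯SF₁ (n : ℕ) : Set where
  𝟎 𝟏         : 𝒯SF₁ n
  letter      : Fin n → 𝒯SF₁ n
  _+_ _·_ _⊗_ : 𝒯SF₁ n → 𝒯SF₁ n → 𝒯SF₁ n
  _⋆ H        : 𝒯SF₁ n → 𝒯SF₁ n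

ι : 𝒯SL n → 𝒯SF₁ n
ι (letter a) = letter a
ι (e ⊗ₛₗ f)  = ι e ⊗ ι f

⟦_⟧SL : 𝒯SL n → 𝒫ₙ n
⟦ letter a ⟧SL = ⁅ a ⁆
⟦ e ⊗ₛₗ f ⟧SL  = ⟦ e ⟧SL ⊔ ⟦ f ⟧SL

⟦_⟧SF₁ : 𝒯SF₁ n → SyncLanguage n
⟦ 𝟎 ⟧SF₁        = ∅
⟦ 𝟏 ⟧SF₁        = ｛ [] ｝
⟦ letter a ⟧SF₁ = ｛ [ ⟦ letter a ⟧SL ] ｝
⟦ e + f ⟧SF₁    = ⟦ e ⟧SF₁ ∪ ⟦ f ⟧SF₁
⟦ e · f ⟧SF₁    = ⟦ e ⟧SF₁ ·ᴸ ⟦ f ⟧SF₁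
⟦ e ⊗ f ⟧SF₁    = ⟦ e ⟧SF₁ ⊗ᴸ ⟦ f ⟧SF₁
⟦ e ⋆ ⟧SF₁      = ⟦ e ⟧SF₁ ⋆ᴸ
⟦ H e ⟧SF₁      = ⟦ e ⟧SF₁ ∩ ｛ [] ｝

-- The clause ⟦ a ⟧ = { ⟦ a ⟧SL } holds for every semilattice term a.
⟦ι⟧ : (a : 𝒯SL n) → ⟦ ι a ⟧SF₁ ≐ ｛ [ ⟦ a ⟧SL ] ｝
⟦ι⟧ a = to a , from a
  where
  to : ∀ (a : 𝒯SL n) {w} → w ∈ ⟦ ι a ⟧SF₁ → w ∈ ｛ [ ⟦ a ⟧SL ] ｝
  to (letter a) p = p
  to (e ⊗ₛₗ f) (u , v , p , q , refl) with to e p | to f q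
  ... | refl | refl = refl

  from : ∀ (a : 𝒯SL n) {w} → w ∈ ｛ [ ⟦ a ⟧SL ] ｝ → w ∈ ⟦ ι a ⟧SF₁
  from (letter a) p = p
  from (e ⊗ₛₗ f) refl =
    [ ⟦ e ⟧SL ] , [ ⟦ f ⟧SL ] , from e refl , from f refl , refl

-- The values 0 and 1 are false and true; max and min are _∨_ and _∧_.
o : 𝒯SF₁ n → Bool
o 𝟎          = false
o 𝟏          = true
o (letter a) = false
o (e + f)    = o e ∨ o f
o (e · f)    = o e ∧ o f
o (e ⊗ f)    = o e ∧ o f
o (e ⋆)      = true
o (H e)      = o e

δ : 𝒯SF₁ n → 𝒫ₙ n → Pred (𝒯SF₁ n) 0ℓ
Δ : 𝒯SF₁ n → 𝒯SF₁ n → 𝒫ₙ n → Pred (𝒯SF₁ n) 0ℓ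

δ 𝟎          A = ∅
δ 𝟏          A = ∅
δ (letter a) A = λ g → A ≡ ⁅ a ⁆ × g ∈ ｛ 𝟏 ｝
δ (e + f)    A = δ e A ∪ δ f A
δ (e · f)    A = (λ g → ∃ λ e′ → e′ ∈ δ e A × g ≡ e′ · f) ∪ Δ f e A
δ (e ⊗ f)    A =
  Δ e f A ∪ Δ f e A ∪
  (λ g → ∃₂ λ e′ f′ → ∃₂ λ B₁ B₂ →
     e′ ∈ δ e B₁ × f′ ∈ δ f B₂ × B₁ ⊔ B₂ ≡ A × g ≡ e′ ⊗ f′)
δ (e ⋆)      A = λ g → ∃ λ e′ → e′ ∈ δ e A × g ≡ e′ · e ⋆
δ (H e)      A = ∅

Δ e f A = if o f then δ e A else ∅

syntacticAutomaton : (n : ℕ) → Automaton (𝒫ₙ n)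
syntacticAutomaton n = record
  { State       = 𝒯SF₁ n
  ; termination = o
  ; transition  = δ
  }

ℓ : 𝒯SF₁ n → SyncLanguage n
ℓ {n} = Automaton.semantics (syntacticAutomaton n)

{-# OPTIONS --safe #-}

-- The automaton semantics ℓ is a homomorphism for every operator of SF₁.
-- Each inclusion is an induction on the word or on the factors into which it is
-- split.
module Submission where

open import Data.Bool.Base using (true; false; _∧_; _∨_)
open import Data.Bool.Properties using (∧-conicalˡ; ∧-conicalʳ)
open import Data.List.Base using ([]; _∷_; _++_)
open import Data.Nat.Base using (ℕ; zero; suc)
open import Data.Product.Base using (_×_; _,_; proj₂; map₂)
open import Data.Sum.Base using (_⊎_; inj₁; inj₂)
open import Relation.Binary.PropositionalEquality using (_≡_; refl; cong; cong₂)
open import Relation.Unary using (_∈_; _⊆_; _≐_; _∪_; _∩_; ｛_｝)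
open import Relation.Unary.Algebra using (∪-cong; ∩-cong)
open import Relation.Unary.Properties using (≐-refl; ≐-trans)
open import Defs

-- The proof is by structural induction on the expression. Each operator has a law computing `ℓ` of
-- a compound from `ℓ` of its parts, and congruence of the language operation then lets the
-- induction hypotheses in. The laws for `·`, `⊗` and `⋆` carry the content: the alternatives in `δ`
-- record how an accepting run splits into runs of the operands. A derivative need not be a subterm,
-- so these laws are proved for arbitrary operands, by induction on words.

private
  variable
    n : ℕ
    X : Set
    K K′ L L′ : Language X

·ᴸ-mono : K ⊆ K′ → L ⊆ L′ → K ·ᴸ L ⊆ K′ ·ᴸ L′
·ᴸ-mono K⊆ L⊆ (u , v , p , q , eq) = u , v , K⊆ p , L⊆ q , eq

^ᴸ-mono : ∀ k → K ⊆ L → K ^ᴸ k ⊆ L ^ᴸ k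
^ᴸ-mono zero    K⊆L p = p
^ᴸ-mono (suc k) K⊆L p = ·ᴸ-mono K⊆L (^ᴸ-mono k K⊆L) p

⊗ᴸ-mono : {K K′ L L′ : SyncLanguage n} →
          K ⊆ K′ → L ⊆ L′ → K ⊗ᴸ L ⊆ K′ ⊗ᴸ L′
⊗ᴸ-mono K⊆ L⊆ (u , v , p , q , eq) = u , v , K⊆ p , L⊆ q , eq

·ᴸ-cong : K ≐ K′ → L ≐ L′ → K ·ᴸ L ≐ K′ ·ᴸ L′
·ᴸ-cong (K⊆ , K⊇) (L⊆ , L⊇) = ·ᴸ-mono K⊆ L⊆ , ·ᴸ-mono K⊇ L⊇

⊗ᴸ-cong : {K K′ L L′ : SyncLanguage n} →
          K ≐ K′ → L ≐ L′ → K ⊗ᴸ L ≐ K′ ⊗ᴸ L′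
⊗ᴸ-cong (K⊆ , K⊇) (L⊆ , L⊇) = ⊗ᴸ-mono K⊆ L⊆ , ⊗ᴸ-mono K⊇ L⊇

⋆ᴸ-cong : K ≐ L → K ⋆ᴸ ≐ L ⋆ᴸ
⋆ᴸ-cong (K⊆L , L⊆K) = map₂ (λ {k} → ^ᴸ-mono k K⊆L) , map₂ (λ {k} → ^ᴸ-mono k L⊆K)

∧-true⁻ : ∀ a b → a ∧ b ≡ true → a ≡ true × b ≡ true
∧-true⁻ a b p = ∧-conicalˡ a b p , ∧-conicalʳ a b p

Δ⁻ : (e f : 𝒯SF₁ n) {A : 𝒫ₙ n} {g : 𝒯SF₁ n} →
     g ∈ Δ e f A → o f ≡ true × g ∈ δ e A
Δ⁻ e f d with true ← o f = refl , d

Δ⁺ : (e f : 𝒯SF₁ n) {A : 𝒫ₙ n} {g : 𝒯SF₁ n} →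
     o f ≡ true → g ∈ δ e A → g ∈ Δ e f A
Δ⁺ e f eq d with true ← o f = d

ℓ-𝟏 : ℓ {n} 𝟏 ≐ ｛ [] ｝
ℓ-𝟏 = (λ { {[]} _ → refl }) , λ { refl → refl }

ℓ-letter : ∀ a → ℓ {n} (letter a) ≐ ⟦ letter a ⟧SF₁
ℓ-letter a = (λ { {A ∷ []} (_ , (refl , refl) , _) → refl })
           , λ { refl → 𝟏 , (refl , refl) , refl }

ℓ-H : (e : 𝒯SF₁ n) → ℓ (H e) ≐ ℓ e ∩ ｛ [] ｝
ℓ-H e = (λ { {[]} p → p , refl }) , λ { (p , refl) → p }

ℓ-+ : (e f : 𝒯SF₁ n) → ℓ (e + f) ≐ ℓ e ∪ ℓ f
ℓ-+ e f = to _ , from _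
  where
  ∨-true⁻ : ∀ a b → a ∨ b ≡ true → a ≡ true ⊎ b ≡ true
  ∨-true⁻ true  b p = inj₁ refl
  ∨-true⁻ false b p = inj₂ p

  to : ∀ w → w ∈ ℓ (e + f) → w ∈ ℓ e ∪ ℓ f
  to []      p                = ∨-true⁻ (o e) (o f) p
  to (x ∷ w) (g , inj₁ d , p) = inj₁ (g , d , p)
  to (x ∷ w) (g , inj₂ d , p) = inj₂ (g , d , p)

  from : ∀ w → w ∈ ℓ e ∪ ℓ f → w ∈ ℓ (e + f)
  from []      (inj₁ p) rewrite p = refl
  from []      (inj₂ p) with o e
  ... | true  = refl
  ... | false = p
  from (x ∷ w) (inj₁ (g , d , p)) = g , inj₁ d , p
  from (x ∷ w) (inj₂ (g , d , p)) = g , inj₂ d , p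

-- A run follows derivatives of the left operand until that operand accepts the empty word and `Δ`
-- hands over to `f`; the word splits at the handover. Only the left operand changes before it, so
-- `f` stays fixed in the induction.
ℓ-· : (e f : 𝒯SF₁ n) → ℓ (e · f) ≐ ℓ e ·ᴸ ℓ f
ℓ-· e f = to e _ , λ { (u , v , p , q , refl) → from e u v p q }
  where
  to : ∀ e w → w ∈ ℓ (e · f) → w ∈ ℓ e ·ᴸ ℓ f
  to e [] p with oe , of ← ∧-true⁻ (o e) (o f) p = [] , [] , oe , of , refl
  to e (x ∷ w) (_ , inj₁ (e′ , d , refl) , p)
    with u , v , pu , pv , eq ← to e′ w p =
    x ∷ u , v , (e′ , d , pu) , pv , cong (x ∷_) eq
  to e (x ∷ w) (g , inj₂ d , p) with oe , d′ ← Δ⁻ f e d =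
    [] , x ∷ w , oe , (g , d′ , p) , refl

  from : ∀ e u v → u ∈ ℓ e → v ∈ ℓ f → u ++ v ∈ ℓ (e · f)
  from e []      []      p q = cong₂ _∧_ p q
  from e []      (x ∷ v) p (f′ , d , q) = f′ , inj₂ (Δ⁺ f e p d) , q
  from e (x ∷ u) v       (e′ , d , p) q =
    e′ · f , inj₁ (e′ , d , refl) , from e′ u v p q

-- The three parts of `δ` on a product correspond to the right factor being exhausted, the left
-- factor being exhausted, and both having a letter left to merge.
ℓ-⊗ : (e f : 𝒯SF₁ n) → ℓ (e ⊗ f) ≐ ℓ e ⊗ᴸ ℓ f
ℓ-⊗ e f = to e f _ , λ { (u , v , p , q , refl) → from e f u v p q }
  where
  to : ∀ e f w → w ∈ ℓ (e ⊗ f) → w ∈ ℓ e ⊗ᴸ ℓ f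
  to e f [] p with oe , of ← ∧-true⁻ (o e) (o f) p = [] , [] , oe , of , refl
  to e f (x ∷ w) (g , inj₁ d , p) with of , d′ ← Δ⁻ e f d =
    x ∷ w , [] , (g , d′ , p) , of , refl
  to e f (x ∷ w) (g , inj₂ (inj₁ d) , p) with oe , d′ ← Δ⁻ f e d =
    [] , x ∷ w , oe , (g , d′ , p) , refl
  to e f (_ ∷ w) (_ , inj₂ (inj₂ (e′ , f′ , y , z , d , d′ , refl , refl)) , p)
    with u , v , pu , pv , eq ← to e′ f′ w p =
    y ∷ u , z ∷ v , (e′ , d , pu) , (f′ , d′ , pv) , cong (y ⊔ z ∷_) eq

  from : ∀ e f u v → u ∈ ℓ e → v ∈ ℓ f → u ⊗ˢ v ∈ ℓ (e ⊗ f)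
  from e f []      []      p q = cong₂ _∧_ p q
  from e f []      (y ∷ v) p (f′ , d , q) = f′ , inj₂ (inj₁ (Δ⁺ f e p d)) , q
  from e f (x ∷ u) []      (e′ , d , p) q = e′ , inj₁ (Δ⁺ e f q d) , p
  from e f (x ∷ u) (y ∷ v) (e′ , d , p) (f′ , d′ , q) =
    e′ ⊗ f′ , inj₂ (inj₂ (e′ , f′ , x , y , d , d′ , refl , refl)) ,
    from e′ f′ u v p q

ℓ-⋆ : (e : 𝒯SF₁ n) → ℓ (e ⋆) ≐ ℓ e ⋆ᴸ
ℓ-⋆ e = to _ , λ (k , p) → from k p
  where
  -- Every derivative of e ⋆ has the form g · e ⋆, and so does every derivative
  -- of g · e ⋆; generalising over g makes the induction on the word structural.
  split : ∀ g w → w ∈ ℓ (g · e ⋆) → w ∈ ℓ g ·ᴸ (ℓ e ⋆ᴸ)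
  split g [] p with og , _ ← ∧-true⁻ (o g) true p =
    [] , [] , og , (0 , refl) , refl
  split g (x ∷ w) (_ , inj₁ (g′ , d , refl) , p)
    with u , v , pu , pv , eq ← split g′ w p =
    x ∷ u , v , (g′ , d , pu) , pv , cong (x ∷_) eq
  -- Here `g` stops and `x` starts a new iteration of `e`, which adds one to the exponent.
  split g (x ∷ w) (_ , inj₂ d , p) with Δ⁻ (e ⋆) g d
  ... | og , e′ , d′ , refl with u , v , pu , (k , pv) , eq ← split e′ w p =
    [] , x ∷ w , og ,
    (suc k , x ∷ u , v , (e′ , d′ , pu) , pv , cong (x ∷_) eq) , refl

  to : ∀ w → w ∈ ℓ (e ⋆) → w ∈ ℓ e ⋆ᴸ
  to []      _ = 0 , refl
  to (x ∷ w) (_ , (e′ , d , refl) , p)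
    with u , v , pu , (k , pv) , eq ← split e′ w p =
    suc k , x ∷ u , v , (e′ , d , pu) , pv , cong (x ∷_) eq

  from : ∀ k → ℓ e ^ᴸ k ⊆ ℓ (e ⋆)
  from zero    refl = refl
  -- An empty factor triggers no transition and is dropped; hence the induction on the exponent.
  from (suc k) ([]    , v , p , q , refl) = from k q
  from (suc k) (x ∷ u , v , (e′ , d , p) , q , refl) =
    e′ · e ⋆ , (e′ , d , refl) , proj₂ (ℓ-· e′ (e ⋆)) (u , v , p , from k q , refl)

theorem6p3 : (n : ℕ) (e : 𝒯SF₁ n) → ℓ e ≐ ⟦ e ⟧SF₁
theorem6p3 n 𝟎          = (λ { {[]} () ; {_ ∷ _} () }) , λ ()
theorem6p3 n 𝟏          = ℓ-𝟏
theorem6p3 n (letter a) = ℓ-letter a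
theorem6p3 n (e + f)    = ≐-trans (ℓ-+ e f) (∪-cong (theorem6p3 n e) (theorem6p3 n f))
theorem6p3 n (e · f)    = ≐-trans (ℓ-· e f) (·ᴸ-cong (theorem6p3 n e) (theorem6p3 n f))
theorem6p3 n (e ⊗ f)    = ≐-trans (ℓ-⊗ e f) (⊗ᴸ-cong (theorem6p3 n e) (theorem6p3 n f))
theorem6p3 n (e ⋆)      = ≐-trans (ℓ-⋆ e) (⋆ᴸ-cong (theorem6p3 n e))
theorem6p3 n (H e)      = ≐-trans (ℓ-H e) (∩-cong (theorem6p3 n e) ≐-refl)
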